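{- Let $r\ge1$ and $\mathbb A=\{1,\dots,r\}$. Let $\phi_{SF}:\mathbb Z[q,q^{ -1}]\langle\langle\mathcal B\rangle\rangle\to\mathbb Z[t,t^{ -1},q,q^{ -1}]\langle\langle\mathcal B\rangle\rangle$ be the linear map defined on biwords by $\phi_{SF}(\alpha)=t^{\mathrm{exc}\,\alpha}q^{\mathrm{inv}^-\alpha}\alpha$. Then: (i) $\phi_{SF}([E]_{SF})=[\phi_{SF}(E)]_{SF_q}$ for every $E\in\mathbb Z[q,q^{ -1}]\langle\langle\mathcal B\rangle\rangle$; (ii) $\phi_{SF}(EF)=\phi_{SF}(E)\,\phi_{SF}(F)$ whenever $E$ and $F$ are circular expressions.
   Context: A biword on $\mathbb A$ is a $2\times n$ matrix $\binom{x_1\cdots x_n}{a_1\cdots a_n}$ ($n\ge 0$) with entries in $\mathbb A$; the first row is its top word and the second row its bottom word. Biwords are viewed as words in biletters $\binom{x_i}{a_i}$ and multiplied by concatenation. $\mathcal B$ is the set of biwords, and $R\langle\langle\mathcal B\rangle\rangle$ is the algebra of formal sums $\sum_\alpha c(\alpha)\alpha$ with $c(\alpha)\in R$. For a word $w$, $\mathrm{inv}\,w$ is the number of pairs $i<j$ with $w_i>w_j$. For $\alpha=\binom{u}{v}$: - $\mathrm{inv}^-\alpha=\mathrm{inv}\,v-\mathrm{inv}\,u$; - $\mathrm{exc}\,\alpha=\#\{i:a_i>x_i\}$. A circuit is a biword whose top word is a rearrangement of its bottom word. A circular expression is one in which only circuits have nonzero coefficients. A reduction system is a set of pairs $(\alpha,E_\alpha)$,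 where $\alpha$ is a biword (the first components are distinct) and $E_\alpha$ is a finite linear combination of biwords. We use two of them: - $SF$ consists of $(\binom{xy}{ab},\binom{yx}{ba})$ for all $x>y$ and all $a,b\in\mathbb A$, with coefficients in $\mathbb Z[q,q^{ -1}]$. - $SF_q$ consists, for all $x>y$, of $(\binom{xy}{ab},\binom{yx}{ba})$ if $a>b$, $(\binom{xy}{ab},q\binom{yx}{ba})$ if $a=b$, and $(\binom{xy}{ab},q^2\binom{yx}{ba})$ if $a<b$, with coefficients in $\mathbb Z[t^{\pm1},q^{\pm1}]$. For a reduction system $S$, a biword is irreducible if none of its factors of consecutive biletters is a first component. The leftmost reduction $[\ \cdot\ ]_S$ is the linear map (applied termwise) defined as follows: - $[\beta]_S=\beta$ for irreducible $\beta$; - otherwise write uniquely $\beta=\beta_1\beta_2\binom{x}{a}\beta_3$ with $\beta_1\beta_2$ irreducible and $\beta_2\binom{x}{a}=\alpha$ a first component, and set $[\beta]_S=[\beta_1E_\alpha\beta_3]_S$. -}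

module Defs where

open import Data.Nat as ℕ using (ℕ; zero; suc)
open import Data.Integer as ℤ using (ℤ; +_)
open import Data.Fin as Fin using (Fin)
open import Data.Fin.Properties as FinP using ()
open import Data.Product using (_×_; _,_; proj₁; proj₂)
open import Data.Product.Properties as ProdP using ()
open import Data.List using (List; []; _∷_; _++_; map; concatMap; filter; length; allFin; cartesianProduct; upTo; take; drop; foldr)
open import Data.List.Properties as ListP using ()
open import Data.List.Relation.Binary.Permutation.Propositional using (_↭_)
open import Data.Maybe using (Maybe; just; nothing)
open import Relation.Nullary using (¬_; yes; no)
open import Relation.Binary.PropositionalEquality using (_≡_)
open import Relation.Binary.Definitions using (tri<; tri≈; tri>)
open import Relation.Nullary using (Dec)

-- Laurent polynomials with integer coefficients.
-- LP1 : Z[q,q⁻¹], a finite list of terms (c , e) meaning c·q^e.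
-- LP2 : Z[t,t⁻¹,q,q⁻¹], terms (c , i , j) meaning c·t^i·q^j.
-- Two representations denote the same polynomial iff all coefficients agree.

LP1 : Set
LP1 = List (ℤ × ℤ)

LP2 : Set
LP2 = List (ℤ × ℤ × ℤ)

coeff1 : LP1 → ℤ → ℤ
coeff1 [] e = + 0
coeff1 ((c , e') ∷ p) e with e' ℤ.≟ e
... | yes _ = c ℤ.+ coeff1 p e
... | no  _ = coeff1 p e

coeff2 : LP2 → ℤ → ℤ → ℤ
coeff2 [] i j = + 0
coeff2 ((c , i' , j') ∷ p) i j with i' ℤ.≟ i | j' ℤ.≟ j
... | yes _ | yes _ = c ℤ.+ coeff2 p i j
... | _     | _     = coeff2 p i j

zero1 : LP1
zero1 = []

one1 : LP1
one1 = (+ 1 , + 0) ∷ []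

_+₁_ : LP1 → LP1 → LP1
_+₁_ = _++_

_*₁_ : LP1 → LP1 → LP1
p *₁ p' = cartesianProductWith' p p'
  where
  cartesianProductWith' : LP1 → LP1 → LP1
  cartesianProductWith' a b =
    concatMap (λ { (c , e) → map (λ { (c' , e') → (c ℤ.* c' , e ℤ.+ e') }) b }) a

zero2 : LP2
zero2 = []

one2 : LP2
one2 = (+ 1 , + 0 , + 0) ∷ []

_+₂_ : LP2 → LP2 → LP2
_+₂_ = _++_

_*₂_ : LP2 → LP2 → LP2
a *₂ b = concatMap (λ { (c , i , j) →
           map (λ { (c' , i' , j') → (c ℤ.* c' , i ℤ.+ i' , j ℤ.+ j') }) b }) a

embed : LP1 → LP2
embed = map (λ { (c , e) → (c , + 0 , e) })

mono2 : ℤ → ℤ → LP2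
mono2 i j = (+ 1 , i , j) ∷ []

-- Biwords on the alphabet A = {1,…,r}, encoded as Fin r with its usual order.
-- A biletter (x , a) has top letter x and bottom letter a.

Biletter : ℕ → Set
Biletter r = Fin r × Fin r

Biword : ℕ → Set
Biword r = List (Biletter r)

top : ∀ {r} → Biword r → List (Fin r)
top = map proj₁

bottom : ∀ {r} → Biword r → List (Fin r)
bottom = map proj₂

countBelow : ∀ {r} → Fin r → List (Fin r) → ℕ
countBelow a w = length (filter (λ b → b Fin.<? a) w)

inv : ∀ {r} → List (Fin r) → ℕ
inv []      = 0
inv (a ∷ w) = countBelow a w ℕ.+ inv w

invMinus : ∀ {r} → Biword r → ℤ
invMinus α = + inv (bottom α) ℤ.- + inv (top α)

exc : ∀ {r} → Biword r → ℕ
exc α = length (filter (λ { (x , a) → x Fin.<? a }) α)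

Circuit : ∀ {r} → Biword r → Set
Circuit α = top α ↭ bottom α

allBiletters : ∀ r → List (Biletter r)
allBiletters r = cartesianProduct (allFin r) (allFin r)

allBiwords : ∀ r → ℕ → List (Biword r)
allBiwords r zero    = [] ∷ []
allBiwords r (suc n) = concatMap (λ b → map (b ∷_) (allBiwords r n)) (allBiletters r)

-- Formal sums R⟨⟨B⟩⟩ : coefficient functions on biwords.

FS1 : ℕ → Set
FS1 r = Biword r → LP1

FS2 : ℕ → Set
FS2 r = Biword r → LP2

_≈FS2_ : ∀ {r} → FS2 r → FS2 r → Set
F ≈FS2 G = ∀ β i j → coeff2 (F β) i j ≡ coeff2 (G β) i j

Circular : ∀ {r} → FS1 r → Set
Circular E = ∀ α → ¬ Circuit α → ∀ e → coeff1 (E α) e ≡ + 0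

_⋆₁_ : ∀ {r} → FS1 r → FS1 r → FS1 r
(E ⋆₁ F) γ = foldr _+₁_ zero1 (map (λ k → E (take k γ) *₁ F (drop k γ)) (upTo (suc (length γ))))

_⋆₂_ : ∀ {r} → FS2 r → FS2 r → FS2 r
(E ⋆₂ F) γ = foldr _+₂_ zero2 (map (λ k → E (take k γ) *₂ F (drop k γ)) (upTo (suc (length γ))))

φSF : ∀ {r} → FS1 r → FS2 r
φSF E β = mono2 (+ exc β) (invMinus β) *₂ embed (E β)

-- Reduction systems whose first components are biwords of length two and
-- whose right-hand sides have the form E_α = c · (the two biletters swapped).
-- Such a system is given by   rule b₁ b₂ = just c   iff  (b₁ b₂ , c·b₂ b₁) ∈ S,
-- and  rule b₁ b₂ = nothing  iff  b₁ b₂ is not a first component.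

module Reduction {r : ℕ} {R : Set} (_·_ : R → R → R) (one : R)
                 (rule : Biletter r → Biletter r → Maybe R) where

  step : Biword r → Maybe (R × Biword r)
  step []       = nothing
  step (b ∷ w)  = stepFrom b w
    where
    stepFrom : Biletter r → Biword r → Maybe (R × Biword r)
    stepFrom b₁ []        = nothing
    stepFrom b₁ (b₂ ∷ w) with rule b₁ b₂
    ... | just c  = just (c , b₂ ∷ b₁ ∷ w)
    ... | nothing with stepFrom b₂ w
    ...   | nothing        = nothing
    ...   | just (c , w')  = just (c , b₁ ∷ w')

  reduceFuel : ℕ → Biword r → R × Biword r
  reduceFuel zero    w = (one , w)
  reduceFuel (suc n) w with step w
  ... | nothing       = (one , w)
  ... | just (c , w') with reduceFuel n w'
  ...   | (d , w'') = (c · d , w'')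

  -- [β]_S = c · β' ; for the systems below every step is an adjacent swap of
  -- biletters with x > y on top, decreasing inv (top) by one, so
  -- (length β)² steps always suffice to reach an irreducible biword.
  reduce : Biword r → R × Biword r
  reduce w = reduceFuel (length w ℕ.* length w) w

_≟BW_ : ∀ {r} (u v : Biword r) → Dec (u ≡ v)
_≟BW_ = ListP.≡-dec (ProdP.≡-dec FinP._≟_ FinP._≟_)

ruleSF : ∀ {r} → Biletter r → Biletter r → Maybe LP1
ruleSF (x , a) (y , b) with y Fin.<? x
... | yes _ = just one1
... | no  _ = nothing

ruleSFq : ∀ {r} → Biletter r → Biletter r → Maybe LP2
ruleSFq (x , a) (y , b) with y Fin.<? x
... | no  _ = nothing
... | yes _ with FinP.<-cmp a b
...   | tri< _ _ _ = just (mono2 (+ 0) (+ 2))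
...   | tri≈ _ _ _ = just (mono2 (+ 0) (+ 1))
...   | tri> _ _ _ = just (mono2 (+ 0) (+ 0))

module RSF  {r : ℕ} = Reduction {r} _*₁_ one1 ruleSF
module RSFq {r : ℕ} = Reduction {r} _*₂_ one2 ruleSFq

-- The leftmost reductions extended linearly (termwise) to formal sums:
-- [E]_S (β) = Σ_α E(α) · c_α  over α with [α]_S = c_α · β.
-- Reductions preserve length, so it suffices to sum over α of length |β|.

bracketSF : ∀ {r} → FS1 r → FS1 r
bracketSF {r} E β =
  foldr _+₁_ zero1
    (map (λ α → E α *₁ proj₁ (RSF.reduce α))
         (filter (λ α → proj₂ (RSF.reduce α) ≟BW β) (allBiwords r (length β))))

bracketSFq : ∀ {r} → FS2 r → FS2 r
bracketSFq {r} E β =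
  foldr _+₂_ zero2
    (map (λ α → E α *₂ proj₁ (RSFq.reduce α))
         (filter (λ α → proj₂ (RSFq.reduce α) ≟BW β) (allBiwords r (length β))))

{-# OPTIONS --safe #-}
-- The two systems rewrite the same factors in the same order.  A step at a
-- factor with x > y preserves exc and lowers inv of the top word by one, while
-- it changes inv of the bottom word by −1, 0 or 1 according as a > b, a = b or
-- a < b; so inv⁻ grows by exactly the exponent of q in the corresponding rule
-- of SF_q.  For products, exc is additive, and inv (u u') − inv u − inv u' is
-- the number of pairs (a , b) ∈ u × u' with a > b, which depends only on the
-- letters of u and u'; for circuits it is therefore the same for the top and
-- the bottom words, and inv⁻ is additive too.
module Submission where

open import Defs
open import Data.Nat using (ℕ; zero; suc; _≤_)
import Data.Nat as ℕ
open import Data.Nat.ListAction using (sum)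
open import Data.Nat.ListAction.Properties using (sum-↭)
import Data.Nat.Tactic.RingSolver as ℕ-Ring
open import Data.Integer using (ℤ; +_; _+_; _*_; _-_; _≟_)
open import Data.Integer.Properties using (+-identityˡ; +-identityʳ; +-assoc; *-identityˡ; *-identityʳ; *-zeroʳ; pos-+)
open import Data.Integer.Tactic.RingSolver using (solve-∀)
open import Data.Fin as Fin using (Fin)
import Data.Fin.Properties as Finₚ
open import Data.List using (List; []; _∷_; _++_; map; concat; filter; length; take; drop; upTo)
open import Data.List.Properties using (map-++; map-∘; map-cong; map-cong-local; concat-map; filter-accept; filter-reject; filter-++; filter-≐; length-++; take++drop≡id)
import Data.List.Relation.Unary.All as All
open import Data.List.Relation.Unary.All.Properties using (all-filter)
open import Data.List.Relation.Binary.Permutation.Propositional using (_↭_; ↭-refl; ↭-trans; ↭-prep; ↭-swap)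
open import Data.List.Relation.Binary.Permutation.Propositional.Properties using (map⁺; filter-↭; ↭-length)
open import Data.Maybe.Relation.Binary.Pointwise using (Pointwise; just; nothing)
open import Data.Maybe using (Maybe; just; nothing)
open import Data.Product using (_×_; _,_; proj₁; proj₂)
open import Data.Unit using (⊤)
open import Relation.Binary.Definitions using (tri<; tri≈; tri>)
open import Relation.Binary.PropositionalEquality using (_≡_; refl; sym; trans; cong; cong₂; subst; module ≡-Reasoning)
open import Relation.Nullary using (¬_; Dec; yes; no; contradiction)
open import Relation.Nullary.Decidable using (decidable-stable; ¬¬-excluded-middle)

open ≡-Reasoning

-- Coefficients of Laurent polynomials

-- Written as a factor, the test on exponents in `coeff1` and `coeff2` becomes ring arithmetic,
-- which the solver can handle.
δ : ℤ → ℤ → ℤ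
δ i j with i ≟ j
... | yes _ = + 1
... | no  _ = + 0

δ-+ : ∀ a b c → δ (a + b) c ≡ δ b (c - a)
δ-+ a b c with a + b ≟ c | b ≟ c - a
... | yes _ | yes _ = refl
... | no  _ | no  _ = refl
... | yes p | no ¬q = contradiction (trans (cancel a b) (cong (_- a) p)) ¬q
  where
  cancel : ∀ a b → b ≡ a + b - a
  cancel = solve-∀
... | no ¬p | yes q = contradiction (trans (cong (_+_ a) q) (cancel a c)) ¬p
  where
  cancel : ∀ a c → a + (c - a) ≡ c
  cancel = solve-∀

coeff1-∷ : ∀ c e p k → coeff1 ((c , e) ∷ p) k ≡ c * δ e k + coeff1 p k
coeff1-∷ c e p k with e ≟ k
... | yes _ = cong (_+ coeff1 p k) (sym (*-identityʳ c))
... | no  _ = sym (trans (cong (_+ coeff1 p k) (*-zeroʳ c)) (+-identityˡ _))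

coeff2-∷ : ∀ c i j p k l → coeff2 ((c , i , j) ∷ p) k l ≡ c * (δ i k * δ j l) + coeff2 p k l
coeff2-∷ c i j p k l with i ≟ k | j ≟ l
... | yes _ | yes _ = cong (_+ coeff2 p k l) (sym (*-identityʳ c))
... | yes _ | no  _ = sym (trans (cong (_+ coeff2 p k l) (*-zeroʳ c)) (+-identityˡ _))
... | no  _ | yes _ = sym (trans (cong (_+ coeff2 p k l) (*-zeroʳ c)) (+-identityˡ _))
... | no  _ | no  _ = sym (trans (cong (_+ coeff2 p k l) (*-zeroʳ c)) (+-identityˡ _))

coeff2-++ : ∀ p q i j → coeff2 (p ++ q) i j ≡ coeff2 p i j + coeff2 q i j
coeff2-++ [] q i j = sym (+-identityˡ _)
coeff2-++ ((c , k , l) ∷ p) q i j = begin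
  coeff2 ((c , k , l) ∷ p ++ q) i j                ≡⟨ coeff2-∷ c k l (p ++ q) i j ⟩
  m + coeff2 (p ++ q) i j                          ≡⟨ cong (_+_ m) (coeff2-++ p q i j) ⟩
  m + (coeff2 p i j + coeff2 q i j)                ≡⟨ +-assoc m _ _ ⟨
  m + coeff2 p i j + coeff2 q i j                  ≡⟨ cong (_+ coeff2 q i j) (coeff2-∷ c k l p i j) ⟨
  coeff2 ((c , k , l) ∷ p) i j + coeff2 q i j      ∎
  where m = c * (δ k i * δ l j)

coeff2-concat-map-cong : ∀ {A : Set} {f g : A → LP2} i j →
  (∀ x → coeff2 (f x) i j ≡ coeff2 (g x) i j) →
  ∀ xs → coeff2 (concat (map f xs)) i j ≡ coeff2 (concat (map g xs)) i j
coeff2-concat-map-cong i j f≈g [] = refl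
coeff2-concat-map-cong {f = f} {g} i j f≈g (x ∷ xs) = begin
  coeff2 (f x ++ concat (map f xs)) i j               ≡⟨ coeff2-++ (f x) _ i j ⟩
  coeff2 (f x) i j + coeff2 (concat (map f xs)) i j   ≡⟨ cong₂ _+_ (f≈g x) (coeff2-concat-map-cong i j f≈g xs) ⟩
  coeff2 (g x) i j + coeff2 (concat (map g xs)) i j   ≡⟨ coeff2-++ (g x) _ i j ⟨
  coeff2 (g x ++ concat (map g xs)) i j               ∎

-- The two expansions of a product of Laurent polynomials, along the terms of
-- either factor, show that it vanishes as soon as one factor does.

coeff2-∷-*₂ : ∀ c k l p q i j →
  coeff2 (((c , k , l) ∷ p) *₂ q) i j ≡ c * coeff2 q (i - k) (j - l) + coeff2 (p *₂ q) i j
coeff2-∷-*₂ c k l p q i j =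
  trans (coeff2-++ (map _ q) (p *₂ q) i j) (cong (_+ coeff2 (p *₂ q) i j) (monomial-*₂ q))
  where
  rearrange : ∀ c c' d x → c * c' * d + c * x ≡ c * (c' * d + x)
  rearrange = solve-∀

  monomial-*₂ : ∀ q → coeff2 (map (λ { (c' , k' , l') → (c * c' , k + k' , l + l') }) q) i j
                    ≡ c * coeff2 q (i - k) (j - l)
  monomial-*₂ [] = sym (*-zeroʳ c)
  monomial-*₂ ((c' , k' , l') ∷ q) = begin
    _ ≡⟨ coeff2-∷ (c * c') (k + k') (l + l') (map _ q) i j ⟩
    c * c' * (δ (k + k') i * δ (l + l') j) + _
      ≡⟨ cong₂ (λ d x → c * c' * d + x) (cong₂ _*_ (δ-+ k k' i) (δ-+ l l' j)) (monomial-*₂ q) ⟩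
    c * c' * (δ k' (i - k) * δ l' (j - l)) + c * coeff2 q (i - k) (j - l)
      ≡⟨ rearrange c c' _ _ ⟩
    c * (c' * (δ k' (i - k) * δ l' (j - l)) + coeff2 q (i - k) (j - l))
      ≡⟨ cong (_*_ c) (coeff2-∷ c' k' l' q (i - k) (j - l)) ⟨
    c * coeff2 ((c' , k' , l') ∷ q) (i - k) (j - l) ∎

coeff2-*₂-∷ : ∀ p c k l q i j →
  coeff2 (p *₂ ((c , k , l) ∷ q)) i j ≡ c * coeff2 p (i - k) (j - l) + coeff2 (p *₂ q) i j
coeff2-*₂-∷ [] c k l q i j = sym (trans (cong (_+ + 0) (*-zeroʳ c)) (+-identityˡ _))
coeff2-*₂-∷ ((c' , k' , l') ∷ p) c k l q i j = begin
  coeff2 (((c' , k' , l') ∷ p) *₂ ((c , k , l) ∷ q)) i j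
    ≡⟨ coeff2-∷-*₂ c' k' l' p ((c , k , l) ∷ q) i j ⟩
  c' * coeff2 ((c , k , l) ∷ q) (i - k') (j - l') + coeff2 (p *₂ ((c , k , l) ∷ q)) i j
    ≡⟨ cong₂ (λ x y → c' * x + y) (coeff2-∷ c k l q (i - k') (j - l')) (coeff2-*₂-∷ p c k l q i j) ⟩
  c' * (c * (δ k (i - k') * δ l (j - l')) + x) + (c * y + z)
    -- `δ k (i - k')` and `δ k' (i - k)` both test whether `k + k'` equals `i`, so the two
    -- expansions treat the product of the head terms alike.
    ≡⟨ cong (λ d → c' * (c * d + x) + (c * y + z)) (cong₂ _*_ (δ-swap k k' i) (δ-swap l l' j)) ⟩
  c' * (c * (δ k' (i - k) * δ l' (j - l)) + x) + (c * y + z)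
    ≡⟨ rearrange c c' _ x y z ⟩
  c * (c' * (δ k' (i - k) * δ l' (j - l)) + y) + (c' * x + z)
    ≡⟨ cong₂ (λ u v → c * u + v) (coeff2-∷ c' k' l' p (i - k) (j - l)) (coeff2-∷-*₂ c' k' l' p q i j) ⟨
  c * coeff2 ((c' , k' , l') ∷ p) (i - k) (j - l) + coeff2 (((c' , k' , l') ∷ p) *₂ q) i j ∎
  where
  x = coeff2 q (i - k') (j - l')
  y = coeff2 p (i - k) (j - l)
  z = coeff2 (p *₂ q) i j

  rearrange : ∀ c c' d x y z → c' * (c * d + x) + (c * y + z) ≡ c * (c' * d + y) + (c' * x + z)
  rearrange = solve-∀

  +-swap : ∀ a b → b + a ≡ a + b
  +-swap = solve-∀

  δ-swap : ∀ a b m → δ a (m - b) ≡ δ b (m - a)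
  δ-swap a b m = trans (sym (δ-+ b a m)) (trans (cong (λ s → δ s m) (+-swap a b)) (δ-+ a b m))

-- A polynomial has many representations, so being zero means that all coefficients vanish, not that
-- the list is empty.
Null1 : LP1 → Set
Null1 p = ∀ e → coeff1 p e ≡ + 0

Null2 : LP2 → Set
Null2 p = ∀ i j → coeff2 p i j ≡ + 0

*-+-zero : ∀ c {x y} → x ≡ + 0 → y ≡ + 0 → c * x + y ≡ + 0
*-+-zero c refl refl = trans (+-identityʳ _) (*-zeroʳ c)

*₂-nullʳ : ∀ p q → Null2 q → Null2 (p *₂ q)
*₂-nullʳ [] q q≈0 i j = refl
*₂-nullʳ ((c , k , l) ∷ p) q q≈0 i j =
  trans (coeff2-∷-*₂ c k l p q i j) (*-+-zero c (q≈0 _ _) (*₂-nullʳ p q q≈0 i j))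

*₂-[] : ∀ p → p *₂ [] ≡ []
*₂-[] [] = refl
*₂-[] (_ ∷ p) = *₂-[] p

*₂-nullˡ : ∀ p q → Null2 p → Null2 (p *₂ q)
*₂-nullˡ p [] p≈0 i j = cong (λ s → coeff2 s i j) (*₂-[] p)
*₂-nullˡ p ((c , k , l) ∷ q) p≈0 i j =
  trans (coeff2-*₂-∷ p c k l q i j) (*-+-zero c (p≈0 _ _) (*₂-nullˡ p q p≈0 i j))

-- Multiplication by t^i q^j

shift : ℤ → ℤ → LP1 → LP2
shift i j = map (λ (c , e) → (c , i , j + e))

-- Makes `φSF` a relabelling of exponents term by term, so that identities can be proved on lists
-- rather than on coefficients.
mono2-*₂-embed : ∀ i j p → mono2 i j *₂ embed p ≡ shift i j p
mono2-*₂-embed i j [] = refl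
mono2-*₂-embed i j ((c , e) ∷ p) =
  cong₂ _∷_ (cong₂ _,_ (*-identityˡ c) (cong (_, j + e) (+-identityʳ i))) (mono2-*₂-embed i j p)

φSF-shift : ∀ {r} (E : FS1 r) β → φSF E β ≡ shift (+ exc β) (invMinus β) (E β)
φSF-shift E β = mono2-*₂-embed (+ exc β) (invMinus β) (E β)

*₁-identityʳ : ∀ p → p *₁ one1 ≡ p
*₁-identityʳ [] = refl
*₁-identityʳ ((c , e) ∷ p) = cong₂ _∷_ (cong₂ _,_ (*-identityʳ c) (+-identityʳ e)) (*₁-identityʳ p)

shift-*₂-mono2 : ∀ i j k p → shift i j p *₂ mono2 (+ 0) k ≡ shift i (j + k) p
shift-*₂-mono2 i j k [] = refl
shift-*₂-mono2 i j k ((c , e) ∷ p) =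
  cong₂ _∷_ (cong₂ _,_ (*-identityʳ c) (cong₂ _,_ (+-identityʳ i) (rearrange j e k))) (shift-*₂-mono2 i j k p)
  where
  rearrange : ∀ j e k → j + e + k ≡ j + k + e
  rearrange = solve-∀

shift-*₂-shift : ∀ i j i' j' p q → shift i j p *₂ shift i' j' q ≡ shift (i + i') (j + j') (p *₁ q)
shift-*₂-shift i j i' j' [] q = refl
shift-*₂-shift i j i' j' ((c , e) ∷ p) q = begin
  _ ≡⟨ cong₂ _++_ (row q) (shift-*₂-shift i j i' j' p q) ⟩
  shift (i + i') (j + j') (map (λ { (c' , e') → (c * c' , e + e') }) q) ++ shift (i + i') (j + j') (p *₁ q)
    -- The pattern-matching lambda written above and the one inside `_*₁_` are distinct functions
    -- that agree on every term.
    ≡⟨ cong (λ s → shift (i + i') (j + j') s ++ shift (i + i') (j + j') (p *₁ q)) (map-cong (λ _ → refl) q) ⟩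
  _ ≡⟨ map-++ _ (map _ q) (p *₁ q) ⟨
  shift (i + i') (j + j') (((c , e) ∷ p) *₁ q) ∎
  where
  rearrange : ∀ j e j' e' → j + e + (j' + e') ≡ j + j' + (e + e')
  rearrange = solve-∀

  row : ∀ q → map (λ { (c' , k , l) → (c * c' , i + k , j + e + l) }) (shift i' j' q)
            ≡ shift (i + i') (j + j') (map (λ { (c' , e') → (c * c' , e + e') }) q)
  row [] = refl
  row ((c' , e') ∷ q) = cong₂ _∷_ (cong (λ s → c * c' , i + i' , s) (rearrange j e j' e')) (row q)

coeff2-shift : ∀ i j p k l → coeff2 (shift i j p) k l ≡ δ i k * coeff1 p (l - j)
coeff2-shift i j [] k l = sym (*-zeroʳ (δ i k))
coeff2-shift i j ((c , e) ∷ p) k l = begin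
  coeff2 ((c , i , j + e) ∷ shift i j p) k l            ≡⟨ coeff2-∷ c i (j + e) (shift i j p) k l ⟩
  c * (δ i k * δ (j + e) l) + coeff2 (shift i j p) k l  ≡⟨ cong₂ (λ x y → c * (δ i k * x) + y) (δ-+ j e l) (coeff2-shift i j p k l) ⟩
  c * (δ i k * δ e (l - j)) + δ i k * coeff1 p (l - j)  ≡⟨ rearrange c (δ i k) _ _ ⟩
  δ i k * (c * δ e (l - j) + coeff1 p (l - j))          ≡⟨ cong (_*_ (δ i k)) (coeff1-∷ c e p (l - j)) ⟨
  δ i k * coeff1 ((c , e) ∷ p) (l - j)                  ∎
  where
  rearrange : ∀ c d x y → c * (d * x) + d * y ≡ d * (c * x + y)
  rearrange = solve-∀

shift-null : ∀ i j p → Null1 p → Null2 (shift i j p)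
shift-null i j p p≈0 k l =
  trans (coeff2-shift i j p k l) (trans (cong (_*_ (δ i k)) (p≈0 _)) (*-zeroʳ (δ i k)))

-- Turns a product formed by `_*₁_` into one formed by `_*₂_`, to which the vanishing lemmas above
-- apply.
shift-factorˡ : ∀ i j p q → shift i j (p *₁ q) ≡ shift i j p *₂ shift (+ 0) (+ 0) q
shift-factorˡ i j p q = sym (trans (shift-*₂-shift i j (+ 0) (+ 0) p q)
  (cong₂ (λ k l → shift k l (p *₁ q)) (+-identityʳ i) (+-identityʳ j)))

shift-*₁-nullˡ : ∀ i j p q → Null1 p → Null2 (shift i j (p *₁ q))
shift-*₁-nullˡ i j p q p≈0 = subst Null2 (sym (shift-factorˡ i j p q))
  (*₂-nullˡ (shift i j p) _ (shift-null i j p p≈0))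

shift-*₁-nullʳ : ∀ i j p q → Null1 q → Null2 (shift i j (p *₁ q))
shift-*₁-nullʳ i j p q q≈0 = subst Null2 (sym (shift-factorˡ i j p q))
  (*₂-nullʳ (shift i j p) _ (shift-null (+ 0) (+ 0) q q≈0))

-- Inversions and excedances

countBelow-↭ : ∀ {r} (a : Fin r) {u v} → u ↭ v → countBelow a u ≡ countBelow a v
countBelow-↭ a u↭v = ↭-length (filter-↭ (λ b → b Fin.<? a) u↭v)

countBelow-< : ∀ {r} {a b : Fin r} w → b Fin.< a → countBelow a (b ∷ w) ≡ suc (countBelow a w)
countBelow-< {a = a} w b<a = cong length (filter-accept (λ b → b Fin.<? a) {xs = w} b<a)

countBelow-≮ : ∀ {r} {a b : Fin r} w → ¬ b Fin.< a → countBelow a (b ∷ w) ≡ countBelow a w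
countBelow-≮ {a = a} w b≮a = cong length (filter-reject (λ b → b Fin.<? a) {xs = w} b≮a)

countBelow-++ : ∀ {r} (a : Fin r) u v → countBelow a (u ++ v) ≡ countBelow a u ℕ.+ countBelow a v
countBelow-++ a u v = trans (cong length (filter-++ (λ b → b Fin.<? a) u v)) (length-++ (filter _ u))

-- Every pair other than `a`, `b` keeps its relative order, so exactly one inversion disappears.
inv-swap-> : ∀ {r} {a b : Fin r} w → b Fin.< a → inv (a ∷ b ∷ w) ≡ suc (inv (b ∷ a ∷ w))
inv-swap-> {a = a} {b} w b<a = begin
  countBelow a (b ∷ w) ℕ.+ (countBelow b w ℕ.+ inv w)        ≡⟨ cong (ℕ._+ _) (countBelow-< w b<a) ⟩
  suc (countBelow a w ℕ.+ (countBelow b w ℕ.+ inv w))        ≡⟨ cong suc (rearrange (countBelow a w) (countBelow b w) (inv w)) ⟩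
  suc (countBelow b w ℕ.+ (countBelow a w ℕ.+ inv w))        ≡⟨ cong (λ n → suc (n ℕ.+ _)) (countBelow-≮ w (Finₚ.<-asym b<a)) ⟨
  suc (countBelow b (a ∷ w) ℕ.+ (countBelow a w ℕ.+ inv w))  ∎
  where
  rearrange : ∀ x y z → x ℕ.+ (y ℕ.+ z) ≡ y ℕ.+ (x ℕ.+ z)
  rearrange = ℕ-Ring.solve-∀

-- The inversions of `u ++ v` with one letter on each side of the cut.
crossings : ∀ {r} → List (Fin r) → List (Fin r) → ℕ
crossings u v = sum (map (λ a → countBelow a v) u)

crossings-↭ : ∀ {r} {u u' v v' : List (Fin r)} → u ↭ u' → v ↭ v' → crossings u v ≡ crossings u' v'
crossings-↭ {u' = u'} {v} u↭u' v↭v' = trans (sum-↭ (map⁺ (λ a → countBelow a v) u↭u'))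
  (cong sum (map-cong (λ a → countBelow-↭ a v↭v') u'))

inv-++ : ∀ {r} (u v : List (Fin r)) → inv (u ++ v) ≡ crossings u v ℕ.+ (inv u ℕ.+ inv v)
inv-++ [] v = refl
inv-++ (a ∷ u) v = begin
  countBelow a (u ++ v) ℕ.+ inv (u ++ v)  ≡⟨ cong₂ ℕ._+_ (countBelow-++ a u v) (inv-++ u v) ⟩
  countBelow a u ℕ.+ countBelow a v ℕ.+ (crossings u v ℕ.+ (inv u ℕ.+ inv v))
    ≡⟨ rearrange (countBelow a u) (countBelow a v) (crossings u v) (inv u) (inv v) ⟩
  countBelow a v ℕ.+ crossings u v ℕ.+ (countBelow a u ℕ.+ inv u ℕ.+ inv v) ∎
  where
  rearrange : ∀ x y c m n → x ℕ.+ y ℕ.+ (c ℕ.+ (m ℕ.+ n)) ≡ y ℕ.+ c ℕ.+ (x ℕ.+ m ℕ.+ n)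
  rearrange = ℕ-Ring.solve-∀

invMinus-++ : ∀ {r} {α β : Biword r} → Circuit α → Circuit β → invMinus (α ++ β) ≡ invMinus α + invMinus β
invMinus-++ {α = α} {β} α-circuit β-circuit = begin
  + inv (bottom (α ++ β)) - + inv (top (α ++ β))
    ≡⟨ cong₂ (λ m n → + m - + n) (expand proj₂) (expand proj₁) ⟩
  + (crossings (bottom α) (bottom β) ℕ.+ (inv (bottom α) ℕ.+ inv (bottom β)))
    - + (crossings (top α) (top β) ℕ.+ (inv (top α) ℕ.+ inv (top β)))
    -- In a circuit both rows have the same letters, so top and bottom have equally many crossings,
    -- and these cancel in the next step.
    ≡⟨ cong (λ c → + (c ℕ.+ (inv (bottom α) ℕ.+ inv (bottom β))) - + (crossings (top α) (top β) ℕ.+ (inv (top α) ℕ.+ inv (top β)))) (crossings-↭ α-circuit β-circuit) ⟨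
  + (crossings (top α) (top β) ℕ.+ (inv (bottom α) ℕ.+ inv (bottom β)))
    - + (crossings (top α) (top β) ℕ.+ (inv (top α) ℕ.+ inv (top β)))
    ≡⟨ cancel (+ crossings (top α) (top β)) (+ inv (bottom α)) (+ inv (bottom β)) (+ inv (top α)) (+ inv (top β)) ⟩
  invMinus α + invMinus β ∎
  where
  expand : (π : Biletter _ → Fin _) →
    inv (map π (α ++ β)) ≡ crossings (map π α) (map π β) ℕ.+ (inv (map π α) ℕ.+ inv (map π β))
  expand π = trans (cong inv (map-++ π α β)) (inv-++ (map π α) (map π β))

  cancel : ∀ c m n k l → c + (m + n) - (c + (k + l)) ≡ m - k + (n - l)
  cancel = solve-∀

exc-++ : ∀ {r} (α β : Biword r) → exc (α ++ β) ≡ exc α ℕ.+ exc β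
exc-++ α β = trans (cong length (filter-++ _ α β)) (length-++ (filter _ α))

exc-↭ : ∀ {r} {α β : Biword r} → α ↭ β → exc α ≡ exc β
exc-↭ α↭β = ↭-length (filter-↭ _ α↭β)

-- The two reductions run in lockstep

-- Both runs from `α` end at the same `β`, and `k` is at once the power of q collected by SF_q and
-- the growth of `invMinus`. The permutation of biletters is kept because it preserves `exc`.
data Related {r} (α : Biword r) : LP1 × Biword r → LP2 × Biword r → Set where
  related : ∀ {β} k → β ↭ α → invMinus β ≡ invMinus α + k → Related α (one1 , β) (mono2 (+ 0) k , β)

Related-refl : ∀ {r} (α : Biword r) → Related α (one1 , α) (one2 , α)
Related-refl α = related (+ 0) ↭-refl (sym (+-identityʳ _))

-- The inversions of a front letter with the letters behind it do not depend on the order of the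
-- latter, so `b` contributes equally to both sides.
invMinus-∷ : ∀ {r} {α β : Biword r} {k} (b : Biletter r) → β ↭ α → invMinus β ≡ invMinus α + k →
  invMinus (b ∷ β) ≡ invMinus (b ∷ α) + k
invMinus-∷ {α = α} {β} {k} (x , a) β↭α eq = begin
  + (countBelow a (bottom β) ℕ.+ inv (bottom β)) - + (countBelow x (top β) ℕ.+ inv (top β))
    ≡⟨ cong₂ (λ m n → + (m ℕ.+ inv (bottom β)) - + (n ℕ.+ inv (top β)))
         (countBelow-↭ a (map⁺ proj₂ β↭α)) (countBelow-↭ x (map⁺ proj₁ β↭α)) ⟩
  + (m ℕ.+ inv (bottom β)) - + (n ℕ.+ inv (top β))    ≡⟨ split (+ m) (+ inv (bottom β)) (+ n) (+ inv (top β)) ⟩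
  + m - + n + invMinus β                              ≡⟨ cong (_+_ (+ m - + n)) eq ⟩
  + m - + n + (invMinus α + k)                        ≡⟨ unsplit (+ m) (+ inv (bottom α)) (+ n) (+ inv (top α)) k ⟩
  + (m ℕ.+ inv (bottom α)) - + (n ℕ.+ inv (top α)) + k ∎
  where
  m = countBelow a (bottom α)
  n = countBelow x (top α)

  split : ∀ m v n u → m + v - (n + u) ≡ m - n + (v - u)
  split = solve-∀

  unsplit : ∀ m v n u k → m - n + (v - u + k) ≡ m + v - (n + u) + k
  unsplit = solve-∀

-- Effect of exchanging two adjacent biletters on `invMinus`.

module _ {r} {x y a b : Fin r} (w : Biword r) (y<x : y Fin.< x) where

  private
    u v : ℤ
    u = + inv (y ∷ x ∷ top w)
    v = + inv (b ∷ a ∷ bottom w)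

    before : ℤ
    before = invMinus ((x , a) ∷ (y , b) ∷ w)

    -- The top row loses one inversion, which adds 1 to the exponent in all three cases; the bottom
    -- row then adds 1, 0 or -1.
    before≡ : before ≡ + inv (a ∷ b ∷ bottom w) - (+ 1 + u)
    before≡ = cong (λ n → + inv (a ∷ b ∷ bottom w) - + n) (inv-swap-> (top w) y<x)

  invMinus-swap-< : a Fin.< b → invMinus ((y , b) ∷ (x , a) ∷ w) ≡ before + + 2
  invMinus-swap-< a<b = begin
    v - u                                              ≡⟨ cong (λ n → + n - u) (inv-swap-> (bottom w) a<b) ⟩
    + 1 + + inv (a ∷ b ∷ bottom w) - u                 ≡⟨ rearrange (+ inv (a ∷ b ∷ bottom w)) u ⟩
    + inv (a ∷ b ∷ bottom w) - (+ 1 + u) + + 2         ≡⟨ cong (_+ + 2) before≡ ⟨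
    before + + 2                                       ∎
    where
    rearrange : ∀ v u → + 1 + v - u ≡ v - (+ 1 + u) + + 2
    rearrange = solve-∀

  invMinus-swap-≡ : a ≡ b → invMinus ((y , b) ∷ (x , a) ∷ w) ≡ before + + 1
  invMinus-swap-≡ refl = begin
    v - u                    ≡⟨ rearrange v u ⟩
    v - (+ 1 + u) + + 1      ≡⟨ cong (_+ + 1) before≡ ⟨
    before + + 1             ∎
    where
    rearrange : ∀ v u → v - u ≡ v - (+ 1 + u) + + 1
    rearrange = solve-∀

  invMinus-swap-> : b Fin.< a → invMinus ((y , b) ∷ (x , a) ∷ w) ≡ before + + 0
  invMinus-swap-> b<a = begin
    v - u                                              ≡⟨ rearrange v u ⟩
    + 1 + v - (+ 1 + u) + + 0                          ≡⟨ cong (λ n → + n - (+ 1 + u) + + 0) (inv-swap-> (bottom w) b<a) ⟨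
    + inv (a ∷ b ∷ bottom w) - (+ 1 + u) + + 0         ≡⟨ cong (_+ + 0) before≡ ⟨
    before + + 0                                       ∎
    where
    rearrange : ∀ v u → v - u ≡ + 1 + v - (+ 1 + u) + + 0
    rearrange = solve-∀

-- The local function stepFrom of step is out of scope here, and the arguments
-- c and v of the enclosing clause step (c ∷ v) are extra parameters of it, so
-- that step (c ∷ v) unfolds to stepFrom c v c v.  Its name is recovered by
-- unification: every underscore below is solved from the equation after it, in
-- which the arguments have been generalised to distinct variables.
module StepFrom {r : ℕ} {R : Set} (_·_ : R → R → R) (one : R)
                (rule : Biletter r → Biletter r → Maybe R) where
  open Reduction _·_ one rule

  Result : Set
  Result = Maybe (R × Biword r)

  mutual
    -- The outer case split of `stepFrom`, as a function of the value of `rule`; `frame` is the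
    -- inner one, as a function of the recursive result.
    branch : Biletter r → Biword r → Biletter r → Maybe R → Biword r → Result
    branch = _

    step-branch : ∀ c b w → step (c ∷ b ∷ w) ≡ branch c (b ∷ w) b (rule c b) w
    step-branch c b w with rule c b | b ∷ w
    ... | _ | _ = refl

  mutual
    frame : Biletter r → Biword r → Biword r → Result → Result
    frame = _

    -- With `c` also as second biletter, the recursive call starts at `c` and is itself an instance
    -- of `branch`.
    branch-frame : ∀ c v b w → branch c v c nothing (b ∷ w) ≡ frame c v (b ∷ w) (branch c v b (rule c b) w)
    branch-frame c v b w with rule c b
    ... | m with branch c v b m w
    ...   | _ with b ∷ w
    ...     | _ = refl

  -- f t and f u are convertible by η for ⊤, as the equation requires, but they
  -- are different terms, so that they can be generalised separately afterwards.
  mutual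
    scrutinee : (⊤ → Biletter r) → ⊤ → ⊤ → Biword r → Biword r → Result
    scrutinee = _

    branch-scrutinee : ∀ f t u v w → branch (f t) v (f u) nothing w ≡ frame (f t) v w (scrutinee f t u v w)
    branch-scrutinee f t u v w = refl

  mutual
    stepFrom : Biletter r → Biword r → Biletter r → Biword r → Result
    stepFrom = _

    scrutinee-stepFrom : ∀ f t u v w → scrutinee f t u v w ≡ stepFrom (f t) v (f u) w
    scrutinee-stepFrom f t u v w with f t | f u
    ... | _ | _ = refl

module SFStep  {r : ℕ} = StepFrom {r} _*₁_ one1 ruleSF
module SFqStep {r : ℕ} = StepFrom {r} _*₂_ one2 ruleSFq

-- Both systems decide whether a factor is reducible by the same test on top letters, so either both
-- step at the same place or neither does.
stepFrom-related : ∀ {r} (c : Biletter r) v b w →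
  Pointwise (Related (b ∷ w)) (SFStep.stepFrom c v b w) (SFqStep.stepFrom c v b w)
stepFrom-related c v b [] = nothing
stepFrom-related c v (x , a) ((y , b) ∷ w) with y Fin.<? x
... | yes y<x with Finₚ.<-cmp a b
...   | tri< a<b _ _ = just (related (+ 2) (↭-swap _ _ ↭-refl) (invMinus-swap-< w y<x a<b))
...   | tri≈ _ a≡b _ = just (related (+ 1) (↭-swap _ _ ↭-refl) (invMinus-swap-≡ w y<x a≡b))
...   | tri> _ _ b<a = just (related (+ 0) (↭-swap _ _ ↭-refl) (invMinus-swap-> w y<x b<a))
stepFrom-related c v (x , a) ((y , b) ∷ w) | no _
  with SFStep.stepFrom c v (y , b) w | SFqStep.stepFrom c v (y , b) w | stepFrom-related c v (y , b) w
... | _ | _ | nothing = nothing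
... | _ | _ | just (related k β↭α eq) = just (related k (↭-prep _ β↭α) (invMinus-∷ (x , a) β↭α eq))

step-related : ∀ {r} (α : Biword r) → Pointwise (Related α) (RSF.step α) (RSFq.step α)
step-related [] = nothing
step-related (b ∷ w) = stepFrom-related b w b w

reduceFuel-related : ∀ {r} n (α : Biword r) → Related α (RSF.reduceFuel n α) (RSFq.reduceFuel n α)
reduceFuel-related zero α = Related-refl α
reduceFuel-related (suc n) α with RSF.step α | RSFq.step α | step-related α
... | _ | _ | nothing = Related-refl α
... | _ | _ | just (related {β} k β↭α eq)
  with RSF.reduceFuel n β | RSFq.reduceFuel n β | reduceFuel-related n β
... | _ | _ | related l γ↭β eq' =
  -- The coefficients multiply by computation: `one1 *₁ one1` is `one1`, and the powers of q combine
  -- into exponent `k + l`.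
  related (k + l) (↭-trans γ↭β β↭α) (trans eq' (trans (cong (_+ l) eq) (+-assoc (invMinus α) k l)))

reduce-related : ∀ {r} (α : Biword r) → Related α (RSF.reduce α) (RSFq.reduce α)
reduce-related α = reduceFuel-related (length α ℕ.* length α) α

-- Compatibility of `φSF` with leftmost reduction.

Related-word : ∀ {r} {α : Biword r} {s s'} → Related α s s' → proj₂ s ≡ proj₂ s'
Related-word (related _ _ _) = refl

-- The weights of `β` and `α` have the same power of t and differ by q^k, which is the coefficient
-- produced by SF_q.
Related-term : ∀ {r} {α β : Biword r} {s s'} p → Related α s s' → proj₂ s ≡ β →
  shift (+ exc β) (invMinus β) (p *₁ proj₁ s) ≡ shift (+ exc α) (invMinus α) p *₂ proj₁ s'
Related-term {α = α} {β} p (related k β↭α eq) refl = begin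
  shift (+ exc β) (invMinus β) (p *₁ one1)            ≡⟨ cong (shift (+ exc β) (invMinus β)) (*₁-identityʳ p) ⟩
  shift (+ exc β) (invMinus β) p                      ≡⟨ cong₂ (λ m j → shift (+ m) j p) (exc-↭ β↭α) eq ⟩
  shift (+ exc α) (invMinus α + k) p                  ≡⟨ shift-*₂-mono2 (+ exc α) (invMinus α) k p ⟨
  shift (+ exc α) (invMinus α) p *₂ mono2 (+ 0) k     ∎

-- Both reductions send the same words `α` to `β`, so the two sums run over the same list and can be
-- compared term by term.
φSF-bracket : ∀ {r} (E : FS1 r) β → φSF (bracketSF E) β ≡ bracketSFq (φSF E) β
φSF-bracket {r} E β = begin
  φSF (bracketSF E) β                                  ≡⟨ φSF-shift (bracketSF E) β ⟩
  shift′ (concat (map term αs))                        ≡⟨ concat-map (map term αs) ⟨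
  concat (map shift′ (map term αs))                    ≡⟨ cong concat (map-∘ αs) ⟨
  concat (map (λ α → shift′ (term α)) αs)              ≡⟨ cong concat (map-cong-local (All.map (λ {α} → term≡ α) (all-filter SF→β? (allBiwords r (length β))))) ⟩
  concat (map termq αs)                                ≡⟨ cong (λ s → concat (map termq s)) (filter-≐ SF→β? SFq→β? ((λ {α} → SF⇒SFq α) , (λ {α} → SFq⇒SF α)) (allBiwords r (length β))) ⟩
  bracketSFq (φSF E) β                                 ∎
  where
  SF→β? : ∀ α → Dec (proj₂ (RSF.reduce α) ≡ β)
  SF→β? α = proj₂ (RSF.reduce α) ≟BW β

  SFq→β? : ∀ α → Dec (proj₂ (RSFq.reduce α) ≡ β)
  SFq→β? α = proj₂ (RSFq.reduce α) ≟BW β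

  αs = filter SF→β? (allBiwords r (length β))

  shift′ : LP1 → LP2
  shift′ = shift (+ exc β) (invMinus β)

  term : Biword r → LP1
  term α = E α *₁ proj₁ (RSF.reduce α)

  termq : Biword r → LP2
  termq α = φSF E α *₂ proj₁ (RSFq.reduce α)

  SF⇒SFq : ∀ α → proj₂ (RSF.reduce α) ≡ β → proj₂ (RSFq.reduce α) ≡ β
  SF⇒SFq α = trans (sym (Related-word (reduce-related α)))

  SFq⇒SF : ∀ α → proj₂ (RSFq.reduce α) ≡ β → proj₂ (RSF.reduce α) ≡ β
  SFq⇒SF α = trans (Related-word (reduce-related α))

  term≡ : ∀ α → proj₂ (RSF.reduce α) ≡ β → shift′ (term α) ≡ termq α
  term≡ α eq = trans (Related-term (E α) (reduce-related α) eq)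
    (cong (_*₂ proj₁ (RSFq.reduce α)) (sym (φSF-shift E α)))

-- Products of circular expressions

module _ {r} (E F : FS1 r) (E-circular : Circular E) (F-circular : Circular F) where

  -- If one factor is not a circuit, its coefficient is zero and both sides vanish; otherwise `exc`
  -- and `invMinus` are additive.
  φSF-⋆-term-dec : ∀ α β → Dec (Circuit α) → Dec (Circuit β) → ∀ i j →
    coeff2 (shift (+ exc (α ++ β)) (invMinus (α ++ β)) (E α *₁ F β)) i j
      ≡ coeff2 (shift (+ exc α) (invMinus α) (E α) *₂ shift (+ exc β) (invMinus β) (F β)) i j
  φSF-⋆-term-dec α β (no ¬cα) _ i j =
    trans (shift-*₁-nullˡ (+ exc (α ++ β)) (invMinus (α ++ β)) (E α) (F β) E≈0 i j)
      (sym (*₂-nullˡ (shift (+ exc α) (invMinus α) (E α)) _ (shift-null (+ exc α) (invMinus α) (E α) E≈0) i j))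
    where E≈0 = E-circular α ¬cα
  φSF-⋆-term-dec α β (yes _) (no ¬cβ) i j =
    trans (shift-*₁-nullʳ (+ exc (α ++ β)) (invMinus (α ++ β)) (E α) (F β) F≈0 i j)
      (sym (*₂-nullʳ (shift (+ exc α) (invMinus α) (E α)) _ (shift-null (+ exc β) (invMinus β) (F β) F≈0) i j))
    where F≈0 = F-circular β ¬cβ
  φSF-⋆-term-dec α β (yes cα) (yes cβ) i j = cong (λ p → coeff2 p i j) (begin
    shift (+ exc (α ++ β)) (invMinus (α ++ β)) (E α *₁ F β)
      ≡⟨ cong₂ (λ k l → shift k l (E α *₁ F β)) (trans (cong +_ (exc-++ α β)) (pos-+ (exc α) (exc β))) (invMinus-++ cα cβ) ⟩
    shift (+ exc α + + exc β) (invMinus α + invMinus β) (E α *₁ F β)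
      ≡⟨ shift-*₂-shift (+ exc α) (invMinus α) (+ exc β) (invMinus β) (E α) (F β) ⟨
    shift (+ exc α) (invMinus α) (E α) *₂ shift (+ exc β) (invMinus β) (F β) ∎)

  -- Equality in ℤ is stable under double negation, so we may assume it decided
  -- whether α and β are circuits.
  φSF-⋆-term : ∀ α β i j →
    coeff2 (shift (+ exc (α ++ β)) (invMinus (α ++ β)) (E α *₁ F β)) i j ≡ coeff2 (φSF E α *₂ φSF F β) i j
  φSF-⋆-term α β i j = trans
    (decidable-stable (_ ≟ _) λ ¬eq → ¬¬-excluded-middle λ cα? → ¬¬-excluded-middle λ cβ? →
      ¬eq (φSF-⋆-term-dec α β cα? cβ? i j))
    (cong (λ p → coeff2 p i j) (sym (cong₂ _*₂_ (φSF-shift E α) (φSF-shift F β))))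

  φSF-⋆ : φSF (E ⋆₁ F) ≈FS2 (φSF E ⋆₂ φSF F)
  φSF-⋆ γ i j = begin
    coeff2 (φSF (E ⋆₁ F) γ) i j
      ≡⟨ cong (λ p → coeff2 p i j) (trans (φSF-shift (E ⋆₁ F) γ)
           (trans (sym (concat-map (map term ks))) (cong concat (sym (map-∘ ks))))) ⟩
    coeff2 (concat (map shifted ks)) i j
      ≡⟨ coeff2-concat-map-cong {f = shifted} {termq} i j shifted≡termq ks ⟩
    coeff2 ((φSF E ⋆₂ φSF F) γ) i j ∎
    where
    ks = upTo (suc (length γ))

    term : ℕ → LP1
    term k = E (take k γ) *₁ F (drop k γ)

    shifted termq : ℕ → LP2
    shifted k = shift (+ exc γ) (invMinus γ) (term k)
    termq k = φSF E (take k γ) *₂ φSF F (drop k γ)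

    shifted≡termq : ∀ k → coeff2 (shifted k) i j ≡ coeff2 (termq k) i j
    shifted≡termq k = trans
      -- Only the `γ` in the weight is split at `k`; `term k` is already expressed by the two
      -- pieces.
      (cong (λ γ′ → coeff2 (shift (+ exc γ′) (invMinus γ′) (term k)) i j) (sym (take++drop≡id k γ)))
      (φSF-⋆-term (take k γ) (drop k γ) i j)

mainTheorem3 : (r : ℕ) → 1 ≤ r →
    ((E : FS1 r) → φSF (bracketSF E) ≈FS2 bracketSFq (φSF E))
    × ((E F : FS1 r) → Circular E → Circular F →
    φSF (E ⋆₁ F) ≈FS2 (φSF E ⋆₂ φSF F))
mainTheorem3 r _ = (λ E β i j → cong (λ p → coeff2 p i j) (φSF-bracket E β)) , φSF-⋆
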